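{- Let $c,s$ be positive integers. If $G$ is a finite simple graph that is $(c,s)$-normal, then $|V(G)|\leq 2^{c+s}$. Equivalently, $N(c,s)\leq 2^{c+s}$.
   Context: A normal cover of a graph $G$ is a pair $(\mathcal C,\mathcal S)$ where $\mathcal C$ is a set of cliques of $G$ covering every vertex of $G$, $\mathcal S$ is a set of stable (independent) sets of $G$ covering every vertex of $G$, and every clique in $\mathcal C$ and every stable set in $\mathcal S$ have a vertex in common. For positive integers $c,s$, a $(c,s)$-normal cover is a normal cover in which every clique of $\mathcal C$ has at most $c$ vertices and every stable set of $\mathcal S$ has at most $s$ vertices; $G$ is $(c,s)$-normal if it admits a $(c,s)$-normal cover. $N(c,s)$ denotes the maximum number of vertices of a $(c,s)$-normal graph. -}

module Defs where

open import Data.Nat using (ℕ; _≤_)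
open import Data.Fin using (Fin)
open import Data.Fin.Subset using (Subset; _∈_; ∣_∣)
open import Data.List using (List)
import Data.List.Membership.Propositional as LM
open import Data.Product using (Σ; ∃; _×_)
open import Relation.Nullary using (¬_)
open import Relation.Binary.PropositionalEquality using (_≡_)

record Graph (n : ℕ) : Set₁ where
  field
    Adj   : Fin n → Fin n → Set
    sym   : ∀ {x y} → Adj x y → Adj y x
    irrefl : ∀ {x} → ¬ Adj x x

module _ {n : ℕ} (G : Graph n) where
  open Graph G

  IsClique : Subset n → Set
  IsClique K = ∀ {x y} → x ∈ K → y ∈ K → ¬ x ≡ y → Adj x y

  IsStable : Subset n → Set
  IsStable T = ∀ {x y} → x ∈ T → y ∈ T → ¬ Adj x y

  record NormalCover (c s : ℕ) : Set where
    field
      cliques  : List (Subset n)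
      stables  : List (Subset n)
      cliques-clique : ∀ {K} → K LM.∈ cliques → IsClique K
      cliques-size   : ∀ {K} → K LM.∈ cliques → ∣ K ∣ ≤ c
      stables-stable : ∀ {T} → T LM.∈ stables → IsStable T
      stables-size   : ∀ {T} → T LM.∈ stables → ∣ T ∣ ≤ s
      cliques-cover  : ∀ (v : Fin n) → Σ (Subset n) (λ K → K LM.∈ cliques × v ∈ K)
      stables-cover  : ∀ (v : Fin n) → Σ (Subset n) (λ T → T LM.∈ stables × v ∈ T)
      meet : ∀ {K T} → K LM.∈ cliques → T LM.∈ stables → ∃ (λ v → v ∈ K × v ∈ T)

  IsNormal : ℕ → ℕ → Set
  IsNormal c s = NormalCover c s

{-# OPTIONS --safe #-}
module Submission where

-- Choose for every vertex v a clique K v and a stable set S v of the cover that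
-- contain v; then K v ∩ S v = {v}.  Colour the vertices red and blue one at a time.
-- A vertex stays alive while K v has no blue and S v no red vertex, and then weighs
-- 2^-(k+s), where k and s count the uncoloured vertices of K v and S v.
-- Colouring x at random preserves the expected total weight apart from the weight of x
-- itself.  Always colour along a smallest uncoloured rest of a clique, of size k, provided
-- that no rest of a stable set is smaller; otherwise exchange the roles.  Let l be the
-- smallest rest of a stable set.  If all k vertices turn red, no vertex
-- is left alive, since that clique meets every stable set; the run costs at most
-- k 2^-(k+l) ≤ 2^-k in total, which is the probability of that event.
-- Inductively the total weight is therefore at most 1.

open import Defs
open import Data.Empty using (⊥-elim)
open import Data.Fin using (Fin; _≟_)
open import Data.Fin.Subset using (Subset; _∈_; _∉_; _-_; ∣_∣; ⊤; inside; outside)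
open import Data.Fin.Subset.Properties using (_∈?_; ∣p∣≤n; ∈⊤; p─⊥≡p; ∣p─q∣≤∣p∣; x∈p∧x≢y⇒x∈p-y; x∈p⇒∣p-x∣<∣p∣; p─q⊆p)
open import Data.List using (List; []; _∷_; map; filter; length; allFin)
open import Data.List.Properties using (map-cong; length-tabulate)
open import Data.List.Extrema.Nat using (argmin; f[argmin]≤f[xs]; argmin-all)
import Data.List.Membership.Propositional as LM
open import Data.List.Membership.Propositional.Properties using (∈-filter⁻)
open import Data.List.Relation.Unary.Any using (here; there)
import Data.List.Relation.Unary.All as All
open import Data.List.Relation.Unary.AllPairs using (_∷_)
open import Data.List.Relation.Unary.Unique.Propositional using (Unique)
open import Data.List.Relation.Unary.Unique.Propositional.Properties using (filter⁺; allFin⁺)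
open import Data.Nat using (ℕ; zero; suc; _≤_; _+_; _*_; _∸_; _^_; z≤n; s≤s; NonZero)
open import Data.Nat.ListAction using (sum)
open import Data.Nat.Properties hiding (_≟_)
open import Data.Nat.Tactic.RingSolver using (solve-∀)
open import Data.Product using (∃; _×_; _,_; proj₁; proj₂)
open import Data.Sum using (_⊎_; inj₁; inj₂)
open import Data.Vec using (_∷_)
open import Function using (id; _∘_)
open import Relation.Nullary using (yes; no; ¬?)
open import Relation.Binary.PropositionalEquality using (_≡_; _≢_; refl; sym; cong)

-- Powers of two, sizes of subsets and minimisers in lists.

+-leftComm : ∀ a b c → a + (b + c) ≡ b + (a + c)
+-leftComm = solve-∀

2^-mono-≤ : ∀ {m n} → m ≤ n → 2 ^ m ≤ 2 ^ n
2^-mono-≤ = ^-monoʳ-≤ 2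

n≤2^n : ∀ n → n ≤ 2 ^ n
n≤2^n zero    = z≤n
n≤2^n (suc n) = +-mono-≤ (m^n>0 2 n) (≤-trans (n≤2^n n) (m≤m+n (2 ^ n) 0))

-- Only an inequality: for `n > m` both exponents are truncated to zero and doubling is no longer
-- exact.
2^[1+m∸n]≤2*2^[m∸n] : ∀ m n → 2 ^ (suc m ∸ n) ≤ 2 ^ (m ∸ n) + 2 ^ (m ∸ n)
2^[1+m∸n]≤2*2^[m∸n] m n = begin
  2 ^ (suc m ∸ n)              ≤⟨ 2^-mono-≤ (m+n∸o≤m+[n∸o] 1 m n) ⟩
  2 * 2 ^ (m ∸ n)              ≡⟨ cong (2 ^ (m ∸ n) +_) (+-identityʳ _) ⟩
  2 ^ (m ∸ n) + 2 ^ (m ∸ n)    ∎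
  where
  open ≤-Reasoning
  m+n∸o≤m+[n∸o] : ∀ m n o → m + n ∸ o ≤ m + (n ∸ o)
  m+n∸o≤m+[n∸o] m n o = m≤n+o⇒m∸n≤o (m + n) o
    (≤-trans (+-monoʳ-≤ m (m≤n+m∸n n o)) (≤-reflexive (+-leftComm m o (n ∸ o))))

∣p∣≤1+∣p-x∣ : ∀ {n} (p : Subset n) x → ∣ p ∣ ≤ suc ∣ p - x ∣
∣p∣≤1+∣p-x∣ (inside  ∷ p) Fin.zero    = ≤-reflexive (cong (suc ∘ ∣_∣) (sym (p─⊥≡p p)))
∣p∣≤1+∣p-x∣ (outside ∷ p) Fin.zero    = m≤n⇒m≤1+n (≤-reflexive (cong ∣_∣ (sym (p─⊥≡p p))))
∣p∣≤1+∣p-x∣ (inside  ∷ p) (Fin.suc x) = s≤s (∣p∣≤1+∣p-x∣ p x)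
∣p∣≤1+∣p-x∣ (outside ∷ p) (Fin.suc x) = ∣p∣≤1+∣p-x∣ p x

length*m≤sum : ∀ {A : Set} (f : A → ℕ) m xs → (∀ x → m ≤ f x) → length xs * m ≤ sum (map f xs)
length*m≤sum f m []       m≤f = z≤n
length*m≤sum f m (x ∷ xs) m≤f = +-mono-≤ (m≤f x) (length*m≤sum f m xs m≤f)

[]-or-∈ : ∀ {A : Set} (xs : List A) → xs ≡ [] ⊎ ∃ (LM._∈ xs)
[]-or-∈ []      = inj₁ refl
[]-or-∈ (x ∷ _) = inj₂ (x , here refl)

∃-minimiser : ∀ {A : Set} (f : A → ℕ) {x xs} → x LM.∈ xs →
              ∃ λ y → y LM.∈ xs × (∀ {z} → z LM.∈ xs → f y ≤ f z)
∃-minimiser f {x} {xs} x∈ = argmin f x xs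
  , argmin-all f x∈ (All.tabulate id)
  , All.lookup (f[argmin]≤f[xs] {f = f} x xs)

-- Partially coloured covers.

-- Coloured vertices are deleted: red ones from the rows, blue ones from the columns.
record System (n : ℕ) : Set where
  field
    free        : Subset n
    row col     : Fin n → Subset n
    alive       : List (Fin n)
    unique      : Unique alive
    ∈row        : ∀ {v} → v LM.∈ alive → v ∈ row v
    ∈col        : ∀ {v} → v LM.∈ alive → v ∈ col v
    row∩col     : ∀ {v x} → v LM.∈ alive → x ∈ row v → x ∈ col v → x ≡ v
    -- A red common vertex would have killed `v`, a blue one `u`; so it is still uncoloured and
    -- available as the next vertex to colour.
    meet        : ∀ {u v} → u LM.∈ alive → v LM.∈ alive →
                  ∃ λ x → x ∈ free × x ∈ row u × x ∈ col v

open System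

-- The counterpart of passing to the complement graph; it lets every argument be given for rows
-- only.
swap : ∀ {n} → System n → System n
swap Γ = record
  { free    = free Γ
  ; row     = col Γ
  ; col     = row Γ
  ; alive   = alive Γ
  ; unique  = unique Γ
  ; ∈row    = ∈col Γ
  ; ∈col    = ∈row Γ
  ; row∩col = λ v∈ x∈c x∈r → row∩col Γ v∈ x∈r x∈c
  ; meet    = λ u∈ v∈ → let (x , x∈f , x∈r , x∈c) = meet Γ v∈ u∈ in x , x∈f , x∈c , x∈r
  }

avoiding : ∀ {n} → Fin n → (Fin n → Subset n) → List (Fin n) → List (Fin n)
avoiding x F = filter (λ v → ¬? (x ∈? F v))

∈-avoiding⁻ : ∀ {n} {x : Fin n} (F : Fin n → Subset n) vs {v} →
              v LM.∈ avoiding x F vs → v LM.∈ vs × x ∉ F v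
∈-avoiding⁻ {x = x} F vs = ∈-filter⁻ (λ v → ¬? (x ∈? F v)) {xs = vs}

∈∉⇒≢ : ∀ {n} {x y : Fin n} {p : Subset n} → y ∈ p → x ∉ p → y ≢ x
∈∉⇒≢ y∈p x∉p refl = x∉p y∈p

-- Colour x red; colouring x blue is restrict x ∘ swap.
restrict : ∀ {n} → Fin n → System n → System n
restrict x Γ = record
  { free    = free Γ - x
  ; row     = λ v → row Γ v - x
  ; col     = col Γ
  ; alive   = avoiding x (col Γ) (alive Γ)
  ; unique  = filter⁺ (λ v → ¬? (x ∈? col Γ v)) (unique Γ)
  ; ∈row    = λ v∈ → let (v∈′ , x∉) = old v∈ in
                x∈p∧x≢y⇒x∈p-y (∈row Γ v∈′) (∈∉⇒≢ (∈col Γ v∈′) x∉)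
  ; ∈col    = ∈col Γ ∘ proj₁ ∘ old
  ; row∩col = λ v∈ y∈r → row∩col Γ (proj₁ (old v∈)) (p─q⊆p _ _ y∈r)
  ; meet    = λ u∈ v∈ →
                let (v∈′ , x∉) = old v∈
                    (y , y∈f , y∈r , y∈c) = meet Γ (proj₁ (old u∈)) v∈′
                    y≢x = ∈∉⇒≢ y∈c x∉
                in y , x∈p∧x≢y⇒x∈p-y y∈f y≢x , x∈p∧x≢y⇒x∈p-y y∈r y≢x , y∈c
  }
  where
  old : ∀ {v} → v LM.∈ avoiding x (col Γ) (alive Γ) → v LM.∈ alive Γ × x ∉ col Γ v
  old = ∈-avoiding⁻ (col Γ) (alive Γ)

-- Change of the total weight when one vertex is coloured.

module _ {n : ℕ} where

  -- Weights are scaled by 2^E, so that halving becomes a decrement of E.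
  weight : ℕ → (R C : Fin n → Subset n) → Fin n → ℕ
  weight E R C v = 2 ^ (E ∸ (∣ R v ∣ + ∣ C v ∣))

  totalWeight : ℕ → (R C : Fin n → Subset n) → List (Fin n) → ℕ
  totalWeight E R C vs = sum (map (weight E R C) vs)

  W : ℕ → System n → ℕ
  W E Γ = totalWeight E (row Γ) (col Γ) (alive Γ)

  weight-swap : ∀ E R C v → weight E R C v ≡ weight E C R v
  weight-swap E R C v = cong (λ m → 2 ^ (E ∸ m)) (+-comm ∣ R v ∣ ∣ C v ∣)

  W-swap : ∀ E Γ → W E (swap Γ) ≡ W E Γ
  W-swap E Γ = cong sum (map-cong (weight-swap E (col Γ) (row Γ)) (alive Γ))

  module _ (R C : Fin n → Subset n) (x : Fin n) (E : ℕ) where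

    R′ C′ : Fin n → Subset n
    R′ v = R v - x
    C′ v = C v - x

    weight-∈row : ∀ v → x ∈ R v → weight (suc E) R C v ≤ weight E R′ C v
    weight-∈row v x∈ = 2^-mono-≤
      (∸-monoʳ-≤ (suc E) (+-monoˡ-≤ ∣ C v ∣ (x∈p⇒∣p-x∣<∣p∣ x∈)))

    weight-∈col : ∀ v → x ∈ C v → weight (suc E) R C v ≤ weight E C′ R v
    weight-∈col v x∈ = ≤-trans (≤-reflexive (weight-swap (suc E) R C v)) (2^-mono-≤
      (∸-monoʳ-≤ (suc E) (+-monoˡ-≤ ∣ R v ∣ (x∈p⇒∣p-x∣<∣p∣ x∈))))

    weight-∉ : ∀ v → weight (suc E) R C v ≤ weight E R′ C v + weight E C′ R v
    weight-∉ v = ≤-trans (2^[1+m∸n]≤2*2^[m∸n] E (∣ R v ∣ + ∣ C v ∣)) (+-mono-≤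
      (2^-mono-≤ (∸-monoʳ-≤ E (+-monoˡ-≤ ∣ C v ∣ (∣p─q∣≤∣p∣ (R v) _))))
      (≤-trans (≤-reflexive (weight-swap E R C v))
        (2^-mono-≤ (∸-monoʳ-≤ E (+-monoˡ-≤ ∣ R v ∣ (∣p─q∣≤∣p∣ (C v) _))))))

    redWeight blueWeight : List (Fin n) → ℕ
    redWeight  vs = totalWeight E R′ C (avoiding x C vs)
    blueWeight vs = totalWeight E C′ R (avoiding x R vs)

    -- If `x` lies in exactly one of `R v` and `C v`, one colour kills `v` and the other doubles its
    -- unscaled weight; if it lies in neither, both colours keep `v`. Death under both colours is
    -- excluded by the hypothesis.
    split-∷ : ∀ v vs → (x ∈ R v → x ∉ C v) →
              weight (suc E) R C v + (redWeight vs + blueWeight vs) ≤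
              redWeight (v ∷ vs) + blueWeight (v ∷ vs)
    split-∷ v vs disj with x ∈? C v | x ∈? R v
    ... | yes x∈C | yes x∈R = ⊥-elim (disj x∈R x∈C)
    ... | yes x∈C | no  _   = ≤-trans (+-monoˡ-≤ _ (weight-∈col v x∈C))
                                (≤-reflexive (+-leftComm _ (redWeight vs) (blueWeight vs)))
    ... | no _    | yes x∈R = ≤-trans (+-monoˡ-≤ _ (weight-∈row v x∈R))
                                (≤-reflexive (sym (+-assoc _ (redWeight vs) (blueWeight vs))))
    ... | no _    | no _    = ≤-trans (+-monoˡ-≤ _ (weight-∉ v))
                                (≤-reflexive (shuffle (weight E R′ C v) (weight E C′ R v)
                                                      (redWeight vs) (blueWeight vs)))
      where
      shuffle : ∀ a b c d → (a + b) + (c + d) ≡ (a + c) + (b + d)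
      shuffle = solve-∀

    totalWeight-split : ∀ vs → (∀ {v} → v LM.∈ vs → x ∈ R v → x ∉ C v) →
                        totalWeight (suc E) R C vs ≤ redWeight vs + blueWeight vs
    totalWeight-split []       _    = z≤n
    totalWeight-split (v ∷ vs) disj = ≤-trans
      (+-monoʳ-≤ (weight (suc E) R C v) (totalWeight-split vs (disj ∘ there)))
      (split-∷ v vs (disj (here refl)))

    -- Only `v = x` can die under both colours; its weight is paid by `m`, and `Unique` ensures that
    -- this happens at most once.
    totalWeight-split-cost : ∀ m vs → Unique vs →
                             (∀ {v} → v LM.∈ vs → v ∈ R v × v ∈ C v) →
                             (∀ {v} → v LM.∈ vs → x ∈ R v → x ∈ C v → x ≡ v) →
                             (∀ {v} → v LM.∈ vs → weight (suc E) R C v ≤ m) →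
                             totalWeight (suc E) R C vs ≤ m + (redWeight vs + blueWeight vs)
    totalWeight-split-cost m []       _ _ _ _ = z≤n
    totalWeight-split-cost m (v ∷ vs) (v∉vs ∷ uniq) own meets cost with x ≟ v
    ... | yes refl with x ∈? C x | x ∈? R x
    -- Both filters drop the head `x`, which `m` pays for. As `x` does not occur again, the tail
    -- splits without cost.
    ...   | yes _  | yes _  = +-mono-≤ (cost (here refl)) (totalWeight-split vs
                                λ u∈ x∈R x∈C → All.lookup v∉vs u∈ (meets (there u∈) x∈R x∈C))
    ...   | no x∉C | _      = ⊥-elim (x∉C (proj₂ (own (here refl))))
    ...   | yes _  | no x∉R = ⊥-elim (x∉R (proj₁ (own (here refl))))
    totalWeight-split-cost m (v ∷ vs) (v∉vs ∷ uniq) own meets cost | no x≢v = begin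
      wt + totalWeight (suc E) R C vs
        ≤⟨ +-monoʳ-≤ wt (totalWeight-split-cost m vs uniq (own ∘ there) (meets ∘ there) (cost ∘ there)) ⟩
      wt + (m + (redWeight vs + blueWeight vs))
        ≡⟨ +-leftComm wt m (redWeight vs + blueWeight vs) ⟩
      m + (wt + (redWeight vs + blueWeight vs))
        ≤⟨ +-monoʳ-≤ m (split-∷ v vs λ x∈R x∈C → x≢v (meets (here refl) x∈R x∈C)) ⟩
      m + (redWeight (v ∷ vs) + blueWeight (v ∷ vs)) ∎
      where
      open ≤-Reasoning
      wt : ℕ
      wt = weight (suc E) R C v

  W-split : ∀ E (Γ : System n) x {k l} →
            (∀ {v} → v LM.∈ alive Γ → k ≤ ∣ row Γ v ∣) →
            (∀ {v} → v LM.∈ alive Γ → l ≤ ∣ col Γ v ∣) →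
            W (suc E) Γ ≤ 2 ^ (suc E ∸ (k + l)) + (W E (restrict x Γ) + W E (restrict x (swap Γ)))
  W-split E Γ x k≤ l≤ =
    totalWeight-split-cost (row Γ) (col Γ) x E _ (alive Γ) (unique Γ)
      (λ v∈ → ∈row Γ v∈ , ∈col Γ v∈) (row∩col Γ)
      (λ v∈ → 2^-mono-≤ (∸-monoʳ-≤ (suc E) (+-mono-≤ (k≤ v∈) (l≤ v∈))))

  -- Runs along a smallest remaining clique or stable set.

  -- The summand n + n keeps the exponents E ∸ (k + l) from being truncated.
  Large : ℕ → System n → Set
  Large E Γ = ∣ free Γ ∣ + (n + n) ≤ E

  Large-restrict : ∀ {E x} Γ → x ∈ free Γ → Large (suc E) Γ → Large E (restrict x Γ)
  Large-restrict Γ x∈ large =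
    ≤-pred (≤-trans (+-monoˡ-≤ (n + n) (x∈p⇒∣p-x∣<∣p∣ x∈)) large)

  -- The inductive step of `W-run`: `r` and `c` are the total weights after red and blue, `a` is the
  -- cost of one vertex. Along the red branch `a` and `b` do not change, because `E` and the length
  -- of the run drop together.
  run-arith : ∀ w a b p k r c → w ≤ a + (r + c) → r + b ≤ p + k * a → c ≤ p →
              w + b ≤ 2 * p + suc k * a
  run-arith w a b p k r c w≤ r≤ c≤ = begin
    w + b                     ≤⟨ +-monoˡ-≤ b w≤ ⟩
    (a + (r + c)) + b         ≡⟨ lhs a r c b ⟩
    (r + b) + (c + a)         ≤⟨ +-mono-≤ r≤ (+-monoˡ-≤ a c≤) ⟩
    (p + k * a) + (p + a)     ≡⟨ rhs p a k ⟩
    2 * p + suc k * a         ∎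
    where
    open ≤-Reasoning
    lhs : ∀ a r c b → (a + (r + c)) + b ≡ (r + b) + (c + a)
    lhs = solve-∀
    rhs : ∀ p a k → (p + k * a) + (p + a) ≡ 2 * p + suc k * a
    rhs = solve-∀

  -- Running along the smaller side matters here: `∣ p ∣ ≤ ∣ q ∣ ≤ 2 ^ ∣ q ∣`.
  run-cost : ∀ E (p q : Subset n) → n + n ≤ E → ∣ p ∣ ≤ ∣ q ∣ →
             ∣ p ∣ * 2 ^ (E ∸ (∣ p ∣ + ∣ q ∣)) ≤ 2 ^ (E ∸ ∣ p ∣)
  run-cost E p q 2n≤E p≤q = begin
    k * 2 ^ (E ∸ (k + l))         ≤⟨ *-monoˡ-≤ _ (≤-trans p≤q (n≤2^n l)) ⟩
    2 ^ l * 2 ^ (E ∸ (k + l))     ≡⟨ ^-distribˡ-+-* 2 l (E ∸ (k + l)) ⟨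
    2 ^ (l + (E ∸ (k + l)))       ≡⟨ cong (λ m → 2 ^ (l + m)) (∸-+-assoc E k l) ⟨
    2 ^ (l + (E ∸ k ∸ l))         ≡⟨ cong (2 ^_) (m+[n∸m]≡n l≤E∸k) ⟩
    2 ^ (E ∸ k)                   ∎
    where
    open ≤-Reasoning
    k l : ℕ
    k = ∣ p ∣
    l = ∣ q ∣
    l≤E∸k : l ≤ E ∸ k
    l≤E∸k = m+n≤o⇒m≤o∸n l (≤-trans (+-mono-≤ (∣p∣≤n q) (∣p∣≤n p)) 2n≤E)

  -- W ≤ 2^E − 2^(E−k) (1 − k 2^−l), rearranged to avoid subtraction; K is what is left of
  -- the clique being coloured.
  W-run : ∀ E (Γ : System n) k l (K : Subset n) → Large E Γ → ∣ K ∣ ≤ k →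
          (∀ {v} → v LM.∈ alive Γ → k ≤ ∣ row Γ v ∣) →
          (∀ {v} → v LM.∈ alive Γ → l ≤ ∣ col Γ v ∣) →
          (∀ {v} → v LM.∈ alive Γ → ∃ λ x → x ∈ free Γ × x ∈ K × x ∈ col Γ v) →
          W E Γ + 2 ^ (E ∸ k) ≤ 2 ^ E + k * 2 ^ (E ∸ (k + l))
  -- Proved by mutual induction with `W-run`: a new run starts at the same `E`, and each coloured
  -- vertex lowers `E`.
  W≤2^E : ∀ E (Γ : System n) → Large E Γ → W E Γ ≤ 2 ^ E

  W-run E Γ k l K large K≤k k≤ l≤ hit with []-or-∈ (alive Γ)
  W-run E Γ k l K large K≤k k≤ l≤ hit | inj₁ none
    rewrite none = ≤-trans (2^-mono-≤ (m∸n≤m E k)) (m≤m+n _ _)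
  W-run E Γ k l K large K≤k k≤ l≤ hit | inj₂ (v , v∈) with hit v∈
  W-run zero Γ k l K large K≤k k≤ l≤ hit | inj₂ _ | x , x∈f , _ =
    ⊥-elim (n≮0 (≤-trans (x∈p⇒∣p-x∣<∣p∣ x∈f) (≤-trans (m≤m+n _ _) large)))
  -- The clique is used up, yet an alive vertex would yield an uncoloured element of it through
  -- `hit`.
  W-run (suc E) Γ zero l K large K≤k k≤ l≤ hit | inj₂ _ | x , x∈f , x∈K , _ =
    ⊥-elim (n≮0 (≤-trans (x∈p⇒∣p-x∣<∣p∣ x∈K) K≤k))
  W-run (suc E) Γ (suc k) l K large K≤k k≤ l≤ hit | inj₂ _ | x , x∈f , x∈K , _ =
    run-arith (W (suc E) Γ) (2 ^ (E ∸ (k + l))) (2 ^ (E ∸ k)) (2 ^ E) k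
      (W E red) (W E (restrict x (swap Γ)))
      (W-split E Γ x k≤ l≤)
      (W-run E red k l (K - x) (Large-restrict Γ x∈f large)
        (≤-pred (≤-trans (x∈p⇒∣p-x∣<∣p∣ x∈K) K≤k))
        (λ v∈ → ≤-pred (≤-trans (k≤ (proj₁ (old v∈))) (∣p∣≤1+∣p-x∣ (row Γ _) x)))
        (l≤ ∘ proj₁ ∘ old)
        (λ v∈ → let (v∈′ , x∉) = old v∈
                    (y , y∈f , y∈K , y∈c) = hit v∈′
                    y≢x = ∈∉⇒≢ y∈c x∉
                in y , x∈p∧x≢y⇒x∈p-y y∈f y≢x , x∈p∧x≢y⇒x∈p-y y∈K y≢x , y∈c))
      -- Once `x` is blue the run is abandoned, and the general bound for `E` suffices.
      (W≤2^E E (restrict x (swap Γ)) (Large-restrict (swap Γ) x∈f large))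
    where
    red : System n
    red = restrict x Γ
    old : ∀ {v} → v LM.∈ alive red → v LM.∈ alive Γ × x ∉ col Γ v
    old = ∈-avoiding⁻ (col Γ) (alive Γ)

  W≤2^E E Γ large with []-or-∈ (alive Γ)
  ... | inj₁ none rewrite none = z≤n
  ... | inj₂ (_ , v∈)
    with ∃-minimiser (λ v → ∣ row Γ v ∣) v∈ | ∃-minimiser (λ v → ∣ col Γ v ∣) v∈
  ... | u , u∈ , row≥ | t , t∈ , col≥
    with ≤-total ∣ row Γ u ∣ ∣ col Γ t ∣
  -- By `run-cost` the total cost of the run is at most the term `2 ^ (E ∸ k)` on the left, which
  -- therefore cancels.
  ... | inj₁ r≤c = +-cancelʳ-≤ _ _ _ (≤-trans
          (W-run E Γ ∣ row Γ u ∣ ∣ col Γ t ∣ (row Γ u) large ≤-refl row≥ col≥ (meet Γ u∈))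
          (+-monoʳ-≤ (2 ^ E) (run-cost E (row Γ u) (col Γ t) (m+n≤o⇒n≤o ∣ free Γ ∣ large) r≤c)))
  ... | inj₂ c≤r = +-cancelʳ-≤ _ _ _ (≤-trans
          (+-monoˡ-≤ _ (≤-reflexive (sym (W-swap E Γ)))) (≤-trans
          (W-run E (swap Γ) ∣ col Γ t ∣ ∣ row Γ u ∣ (col Γ t) large ≤-refl col≥ row≥ (meet (swap Γ) t∈))
          (+-monoʳ-≤ (2 ^ E) (run-cost E (col Γ t) (row Γ u) (m+n≤o⇒n≤o ∣ free Γ ∣ large) c≤r))))

-- From a normal cover to the bound on the number of vertices.

module _ {n : ℕ} (G : Graph n) {c s : ℕ} (N : NormalCover G c s) where
  open NormalCover N

  coverSystem : System n
  coverSystem = record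
    { free    = ⊤
    ; row     = proj₁ ∘ cliques-cover
    ; col     = proj₁ ∘ stables-cover
    ; alive   = allFin n
    ; unique  = allFin⁺ n
    ; ∈row    = λ {v} _ → proj₂ (proj₂ (cliques-cover v))
    ; ∈col    = λ {v} _ → proj₂ (proj₂ (stables-cover v))
    ; row∩col = λ {v} _ → clique∩stable v
    ; meet    = λ {u} {v} _ _ →
                  let (x , x∈K , x∈S) = NormalCover.meet N (proj₁ (proj₂ (cliques-cover u)))
                                                           (proj₁ (proj₂ (stables-cover v)))
                  in x , ∈⊤ , x∈K , x∈S
    }
    where
    -- Two distinct common vertices would be both adjacent and non-adjacent.
    clique∩stable : ∀ v {x} → x ∈ proj₁ (cliques-cover v) → x ∈ proj₁ (stables-cover v) → x ≡ v
    clique∩stable v {x} x∈K x∈S with cliques-cover v | stables-cover v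
    ... | K , K∈ , v∈K | S , S∈ , v∈S with x ≟ v
    ...   | yes x≡v = x≡v
    ...   | no  x≢v = ⊥-elim (stables-stable S∈ x∈S v∈S (cliques-clique K∈ x∈K v∈K x≢v))

  n≤2^[c+s] : n ≤ 2 ^ (c + s)
  n≤2^[c+s] = *-cancelʳ-≤ n (2 ^ (c + s)) (2 ^ M) {{m^n≢0 2 M}} (begin
    n * 2 ^ M                          ≡⟨ cong (_* 2 ^ M) (length-tabulate {n = n} id) ⟨
    length (allFin n) * 2 ^ M          ≤⟨ length*m≤sum _ (2 ^ M) (allFin n) heavy ⟩
    W E coverSystem                    ≤⟨ W≤2^E E coverSystem large ⟩
    2 ^ (c + s + M)                    ≡⟨ ^-distribˡ-+-* 2 (c + s) M ⟩
    2 ^ (c + s) * 2 ^ M                ∎)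
    where
    open ≤-Reasoning
    M E : ℕ
    -- The first `n` accounts for the uncoloured vertices, `n + n` for the slack in `Large`. The
    -- extra `c + s` in `E` makes every initial weight at least `2 ^ M`.
    M = n + (n + n)
    E = c + s + M
    large : Large E coverSystem
    large = ≤-trans (+-monoˡ-≤ (n + n) (∣p∣≤n (⊤ {n}))) (m≤n+m M (c + s))
    heavy : ∀ v → 2 ^ M ≤ weight E (row coverSystem) (col coverSystem) v
    heavy v = 2^-mono-≤ (≤-trans (≤-reflexive (sym (m+n∸m≡n (c + s) M)))
      (∸-monoʳ-≤ E (+-mono-≤ (cliques-size (proj₁ (proj₂ (cliques-cover v))))
                             (stables-size (proj₁ (proj₂ (stables-cover v)))))))

theorem1 : (c s : ℕ) → NonZero c → NonZero s → (n : ℕ) → (G : Graph n) →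
    IsNormal G c s → n ≤ 2 ^ (c + s)
theorem1 c s _ _ n G N = n≤2^[c+s] G N
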